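{- Consider a generalized open map situation $(\mathbb{M},V,J,\mathbb{E},\mathbb{S},J_{\mathbb{E}},J_{\mathbb{S}})$ with an element $0\in V$ such that $J0$ is an initial object of $\mathbb{M}$. Let $A,B$ be objects of $\mathbb{M}$, and let $A\xleftarrow{f}C\xrightarrow{g}B$ be a span in $\mathbb{M}$ where $g$ is any morphism of $\mathbb{M}$ and $f$ is an $(\mathbb{E},\mathbb{S})$-open map. Then the set of spans $$R_{f,g}=\{A\xleftarrow{a}Jv\xrightarrow{b}B \mid v\in V,\ \exists\, c\colon Jv\to C \text{ with } a=f\circ c \text{ and } b=g\circ c\}$$ is a strong path simulation from $A$ to $B$. Consequently, if $A$ and $B$ are $(\mathbb{E},\mathbb{S})$-bisimilar, then there is a strong path bisimulation between them.
   Context: Generalized open map situation: a (locally small) category $\mathbb{M}$, a set $V$ with a function $J\colon V\to\mathrm{ob}(\mathbb{M})$, two small categories $\mathbb{E}$ and $\mathbb{S}$ both with object set $V$, and functors $J_{\mathbb{E}}\colon\mathbb{E}\to\mathbb{M}$, $J_{\mathbb{S}}\colon\mathbb{S}\to\mathbb{M}$ that coincide with $J$ on objects. A morphism $f\colon X\to Y$ of $\mathbb{M}$ is $(\mathbb{E},\mathbb{S})$-open if for every $e\colon v\to w$ in $\mathbb{E}$ and all $x\colon Jv\to X$, $y\colon Jw\to Y$ in $\mathbb{M}$ with $y\circ J_{\mathbb{E}}e=f\circ x$ there are $u\in V$, $e'\colon v\to u$ in $\mathbb{E}$, $s\colon u\to w$ in $\mathbb{S}$ and $x'\colon Ju\to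 X$ in $\mathbb{M}$ with $J_{\mathbb{S}}s\circ J_{\mathbb{E}}e'=J_{\mathbb{E}}e$, $x'\circ J_{\mathbb{E}}e'=x$ and $f\circ x'=y\circ J_{\mathbb{S}}s$. Objects $X,Y$ are $(\mathbb{E},\mathbb{S})$-bisimilar if there are an object $Z$ and $(\mathbb{E},\mathbb{S})$-open maps $Z\to X$, $Z\to Y$. Write $!_X\colon J0\to X$ for the unique morphism. A path simulation from $A$ to $B$ is a set $R$ of spans $A\xleftarrow{a}Jv\xrightarrow{b}B$ ($v\in V$) such that: - initial condition: $A\xleftarrow{!_A}J0\xrightarrow{!_B}B$ is in $R$; - forward closure: for all $A\xleftarrow{a}Jv\xrightarrow{b}B$ in $R$, all $e\colon v\to w$ in $\mathbb{E}$ and $a'\colon Jw\to A$ with $a=a'\circ J_{\mathbb{E}}e$, there are $e'\colon v\to u$ in $\mathbb{E}$, $s\colon u\to w$ in $\mathbb{S}$ and $b'\colon Ju\to B$ with $J_{\mathbb{E}}e=J_{\mathbb{S}}s\circ J_{\mathbb{E}}e'$, $b=b'\circ J_{\mathbb{E}}e'$, and $A\xleftarrow{a'\circ J_{\mathbb{S}}s}Ju\xrightarrow{b'}B$ in $R$. It is a strong path simulation if additionally (backward closure): for all $A\xleftarrow{a}Jv\xrightarrow{b}B$ in $R$ and all $e\colon w\to v$ in $\mathbb{E}$, the span $A\xleftarrow{a\circ J_{\mathbb{E}}e}Jw\xrightarrow{b\circ J_{\mathbb{E}}e}B$ is in $R$. $R$ is a (strong) path bisimulation from $A$ to $B$ if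 $R$ is a (strong) path simulation from $A$ to $B$ and $R^\dagger=\{B\xleftarrow{b}Jv\xrightarrow{a}A\mid (A\xleftarrow{a}Jv\xrightarrow{b}B)\in R\}$ is a (strong) path simulation from $B$ to $A$. -}

module Defs where

open import Level using (Level; suc; _⊔_)
open import Data.Product using (Σ-syntax; _×_; _,_; proj₁)
open import Relation.Binary.Core using (Rel)
open import Relation.Binary.Structures using (IsEquivalence)

-- Hom-sets are setoids: _≈_ is equality of parallel morphisms. The set of
-- objects is a parameter, so that two categories can share it on the nose.
record Category {o} (Obj : Set o) (ℓ e : Level) : Set (o ⊔ suc (ℓ ⊔ e)) where
  infix  4 _≈_ _⇒_
  infixr 9 _∘_
  field
    _⇒_ : Rel Obj ℓ
    _≈_ : ∀ {A B} → Rel (A ⇒ B) e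
    id  : ∀ {A} → A ⇒ A
    _∘_ : ∀ {A B C} → B ⇒ C → A ⇒ B → A ⇒ C

    equiv     : ∀ {A B} → IsEquivalence (_≈_ {A} {B})
    ∘-resp-≈  : ∀ {A B C} {f h : B ⇒ C} {g i : A ⇒ B} →
                f ≈ h → g ≈ i → f ∘ g ≈ h ∘ i
    assoc     : ∀ {A B C D} {f : A ⇒ B} {g : B ⇒ C} {h : C ⇒ D} →
                (h ∘ g) ∘ f ≈ h ∘ (g ∘ f)
    identityˡ : ∀ {A B} {f : A ⇒ B} → id ∘ f ≈ f
    identityʳ : ∀ {A B} {f : A ⇒ B} → f ∘ id ≈ f

  IsInitial : Obj → Set (o ⊔ ℓ ⊔ e)
  IsInitial I = ∀ X → Σ[ i ∈ I ⇒ X ] (∀ (h : I ⇒ X) → i ≈ h)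

-- Functors whose object part is the given function F₀.
record FunctorOver {o o′ ℓ ℓ′ e e′} {Obj : Set o} {Obj′ : Set o′}
                   (C : Category Obj ℓ e) (D : Category Obj′ ℓ′ e′)
                   (F₀ : Obj → Obj′) : Set (o ⊔ ℓ ⊔ e ⊔ ℓ′ ⊔ e′) where
  private
    module C = Category C
    module D = Category D
  field
    F₁           : ∀ {A B} → A C.⇒ B → F₀ A D.⇒ F₀ B
    F-resp-≈     : ∀ {A B} {f g : A C.⇒ B} → f C.≈ g → F₁ f D.≈ F₁ g
    identity     : ∀ {A} → F₁ (C.id {A}) D.≈ D.id
    homomorphism : ∀ {A B C} {f : A C.⇒ B} {g : B C.⇒ C} →
                   F₁ (g C.∘ f) D.≈ F₁ g D.∘ F₁ f

record GeneralizedOpenMapSituation (o ℓ e v ℓᴱ eᴱ ℓˢ eˢ : Level)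
       : Set (suc (o ⊔ ℓ ⊔ e ⊔ v ⊔ ℓᴱ ⊔ eᴱ ⊔ ℓˢ ⊔ eˢ)) where
  field
    Obj : Set o
    𝕄   : Category Obj ℓ e
    V   : Set v
    J   : V → Obj
    𝔼   : Category V ℓᴱ eᴱ
    𝕊   : Category V ℓˢ eˢ
    J𝔼  : FunctorOver 𝔼 𝕄 J
    J𝕊  : FunctorOver 𝕊 𝕄 J

module OpenMaps {o ℓ e v ℓᴱ eᴱ ℓˢ eˢ}
                (G : GeneralizedOpenMapSituation o ℓ e v ℓᴱ eᴱ ℓˢ eˢ) where

  open GeneralizedOpenMapSituation G public
  open Category 𝕄 public
  open Category 𝔼 public using () renaming (_⇒_ to _⇒ᴱ_)
  open Category 𝕊 public using () renaming (_⇒_ to _⇒ˢ_)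
  open FunctorOver J𝔼 public using () renaming (F₁ to J𝔼₁)
  open FunctorOver J𝕊 public using () renaming (F₁ to J𝕊₁)

  IsOpen : ∀ {X Y} → X ⇒ Y → Set (ℓ ⊔ e ⊔ v ⊔ ℓᴱ ⊔ ℓˢ)
  IsOpen {X} {Y} f =
    ∀ {v w} (ε : v ⇒ᴱ w) (x : J v ⇒ X) (y : J w ⇒ Y) →
    y ∘ J𝔼₁ ε ≈ f ∘ x →
    Σ[ u ∈ V ] Σ[ ε′ ∈ v ⇒ᴱ u ] Σ[ s ∈ u ⇒ˢ w ] Σ[ x′ ∈ J u ⇒ X ]
      (J𝕊₁ s ∘ J𝔼₁ ε′ ≈ J𝔼₁ ε) × (x′ ∘ J𝔼₁ ε′ ≈ x) × (f ∘ x′ ≈ y ∘ J𝕊₁ s)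

  Bisimilar : Rel Obj (o ⊔ ℓ ⊔ e ⊔ v ⊔ ℓᴱ ⊔ ℓˢ)
  Bisimilar X Y =
    Σ[ Z ∈ Obj ] (Σ[ f ∈ Z ⇒ X ] IsOpen f) × (Σ[ g ∈ Z ⇒ Y ] IsOpen g)

  -- A set of spans A ← J v → B with v ranging over V. Two spans over the same
  -- v are equal when their legs are, so membership must respect _≈_ in each leg.
  record SpanSet (A B : Obj) (r : Level) : Set (ℓ ⊔ e ⊔ v ⊔ suc r) where
    field
      Contains : ∀ {v} → J v ⇒ A → J v ⇒ B → Set r
      resp     : ∀ {v} {a a′ : J v ⇒ A} {b b′ : J v ⇒ B} →
                 a ≈ a′ → b ≈ b′ → Contains a b → Contains a′ b′

  infix 10 _†
  _† : ∀ {A B r} → SpanSet A B r → SpanSet B A r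
  R † = record
    { Contains = λ b a → Contains a b
    ; resp     = λ b≈b′ a≈a′ → resp a≈a′ b≈b′
    } where open SpanSet R

  R[_,_] : ∀ {A B C} → C ⇒ A → C ⇒ B → SpanSet A B (ℓ ⊔ e)
  R[_,_] {C = C} f g = record
    { Contains = λ {v} a b → Σ[ c ∈ J v ⇒ C ] (a ≈ f ∘ c) × (b ≈ g ∘ c)
    ; resp     = λ a≈a′ b≈b′ (c , a≈fc , b≈gc) →
                   c , trans (sym a≈a′) a≈fc , trans (sym b≈b′) b≈gc
    }
    where
    open module Eq {X Y} = IsEquivalence (equiv {X} {Y}) using (sym; trans)

  module PathSimulations (𝟎 : V) (initial : IsInitial (J 𝟎)) where

    ! : ∀ X → J 𝟎 ⇒ X
    ! X = proj₁ (initial X)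

    record IsPathSimulation {A B r} (R : SpanSet A B r)
           : Set (ℓ ⊔ e ⊔ v ⊔ ℓᴱ ⊔ ℓˢ ⊔ r) where
      open SpanSet R
      field
        initial-condition : Contains (! A) (! B)
        forward-closure :
          ∀ {v} (a : J v ⇒ A) (b : J v ⇒ B) → Contains a b →
          ∀ {w} (ε : v ⇒ᴱ w) (a′ : J w ⇒ A) → a ≈ a′ ∘ J𝔼₁ ε →
          Σ[ u ∈ V ] Σ[ ε′ ∈ v ⇒ᴱ u ] Σ[ s ∈ u ⇒ˢ w ] Σ[ b′ ∈ J u ⇒ B ]
            (J𝔼₁ ε ≈ J𝕊₁ s ∘ J𝔼₁ ε′) × (b ≈ b′ ∘ J𝔼₁ ε′) ×
            Contains (a′ ∘ J𝕊₁ s) b′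

    record IsStrongPathSimulation {A B r} (R : SpanSet A B r)
           : Set (ℓ ⊔ e ⊔ v ⊔ ℓᴱ ⊔ ℓˢ ⊔ r) where
      open SpanSet R
      field
        isPathSimulation : IsPathSimulation R
        backward-closure :
          ∀ {v} (a : J v ⇒ A) (b : J v ⇒ B) → Contains a b →
          ∀ {w} (ε : w ⇒ᴱ v) → Contains (a ∘ J𝔼₁ ε) (b ∘ J𝔼₁ ε)

    IsStrongPathBisimulation : ∀ {A B r} → SpanSet A B r →
                               Set (ℓ ⊔ e ⊔ v ⊔ ℓᴱ ⊔ ℓˢ ⊔ r)
    IsStrongPathBisimulation R =
      IsStrongPathSimulation R × IsStrongPathSimulation (R †)

{-# OPTIONS --safe #-}
module Submission where

open import Defs
open import Level using (Level; _⊔_)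
open import Data.Product using (Σ-syntax; _×_; _,_; proj₁; proj₂)
open import Relation.Binary.Structures using (IsEquivalence)

-- A span lies in `R[ f , g ]` when it factors through `C`, so each closure condition is checked on
-- the factorization `c`. The substantial one is forward closure: an extension `a′` of `a` along `ε`
-- closes a commuting square from `c` to `a′` over `f`, openness of `f` lifts it to `c′`, and
-- `g ∘ c′` extends `b`; nothing is asked of `g`. For bisimilarity, the converse of `R[ f , g ]` has
-- the same spans as `R[ g , f ]`, to which the same argument applies with `g` as the open leg.

module _ {o ℓ e v ℓᴱ eᴱ ℓˢ eˢ : Level}
         (G : GeneralizedOpenMapSituation o ℓ e v ℓᴱ eᴱ ℓˢ eˢ) where

  open OpenMaps G
  private open module Eq {X Y} = IsEquivalence (equiv {X} {Y}) using (refl; sym; trans)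

  infix 4 _⊑_
  _⊑_ : ∀ {A B r r′} → SpanSet A B r → SpanSet A B r′ → Set _
  _⊑_ {A} {B} R S = ∀ {v} {a : J v ⇒ A} {b : J v ⇒ B} →
    SpanSet.Contains R a b → SpanSet.Contains S a b

  R-swap-⊑-† : ∀ {A B C} (f : C ⇒ A) (g : C ⇒ B) → R[ g , f ] ⊑ R[ f , g ] †
  R-swap-⊑-† f g (c , b≈gc , a≈fc) = c , a≈fc , b≈gc

  †-⊑-R-swap : ∀ {A B C} (f : C ⇒ A) (g : C ⇒ B) → R[ f , g ] † ⊑ R[ g , f ]
  †-⊑-R-swap f g (c , a≈fc , b≈gc) = c , b≈gc , a≈fc

  ∘-factor : ∀ {W X Y Z} {h : W ⇒ Z} {k : Y ⇒ Z} {c : W ⇒ Y} {c′ : X ⇒ Y} {i : W ⇒ X} →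
             h ≈ k ∘ c → c′ ∘ i ≈ c → h ≈ (k ∘ c′) ∘ i
  ∘-factor h≈kc c′i≈c = trans h≈kc (trans (∘-resp-≈ refl (sym c′i≈c)) (sym assoc))

  module _ (𝟎 : V) (initial : IsInitial (J 𝟎)) where

    open PathSimulations 𝟎 initial

    -- Needed because `R[ g , f ]` and `R[ f , g ] †` are only extensionally equal: their membership
    -- proofs list the two leg equations in opposite orders.
    isStrongPathSimulation-resp-⊑ :
      ∀ {A B r r′} (R : SpanSet A B r) (S : SpanSet A B r′) → R ⊑ S → S ⊑ R →
      IsStrongPathSimulation R → IsStrongPathSimulation S
    isStrongPathSimulation-resp-⊑ R S R⊑S S⊑R sim = record
      { isPathSimulation = record
        { initial-condition = R⊑S initial-condition
        ; forward-closure = λ a b ab∈S ε a′ a≈a′ε →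
            let u , ε′ , s , b′ , ε≈sε′ , b≈b′ε′ , a′sb′∈R =
                  forward-closure a b (S⊑R ab∈S) ε a′ a≈a′ε
            in u , ε′ , s , b′ , ε≈sε′ , b≈b′ε′ , R⊑S a′sb′∈R
        }
      ; backward-closure = λ a b ab∈S ε → R⊑S (backward-closure a b (S⊑R ab∈S) ε)
      }
      where
      open IsStrongPathSimulation sim
      open IsPathSimulation isPathSimulation

    open⇒isStrongPathSimulation :
      ∀ {A B C} (f : C ⇒ A) (g : C ⇒ B) → IsOpen f → IsStrongPathSimulation R[ f , g ]
    open⇒isStrongPathSimulation {A} {B} {C} f g f-open = record
      { isPathSimulation = record
        { initial-condition =
            -- Uniqueness of maps out of `J 𝟎` makes both legs factor through `! C`.
            ! C , proj₂ (initial A) (f ∘ ! C) , proj₂ (initial B) (g ∘ ! C)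
        ; forward-closure = λ a b (c , a≈fc , b≈gc) ε a′ a≈a′ε →
            let u , ε′ , s , c′ , sε′≈ε , c′ε′≈c , fc′≈a′s =
                  f-open ε c a′ (trans (sym a≈a′ε) a≈fc)
            in u , ε′ , s , g ∘ c′ , sym sε′≈ε , ∘-factor b≈gc c′ε′≈c ,
               -- The lift `c′` itself witnesses membership: the left leg is the lower triangle of
               -- the lifting, the right leg is `g ∘ c′` by choice.
               c′ , sym fc′≈a′s , refl
        }
      ; backward-closure = λ a b (c , a≈fc , b≈gc) ε →
          c ∘ J𝔼₁ ε ,
          trans (∘-resp-≈ a≈fc refl) assoc ,
          trans (∘-resp-≈ b≈gc refl) assoc
      }

    bisimilar⇒strongPathBisimulation :
      ∀ {A B} → Bisimilar A B → Σ[ R ∈ SpanSet A B (ℓ ⊔ e) ] IsStrongPathBisimulation R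
    bisimilar⇒strongPathBisimulation (C , (f , f-open) , (g , g-open)) =
      R[ f , g ] ,
      open⇒isStrongPathSimulation f g f-open ,
      isStrongPathSimulation-resp-⊑ R[ g , f ] (R[ f , g ] †)
        (R-swap-⊑-† f g) (†-⊑-R-swap f g) (open⇒isStrongPathSimulation g f g-open)

theorem4p7 : ∀ {o ℓ e v ℓᴱ eᴱ ℓˢ eˢ : Level}
    (G : GeneralizedOpenMapSituation o ℓ e v ℓᴱ eᴱ ℓˢ eˢ) →
    let open OpenMaps G in
    (𝟎 : V) (initial : IsInitial (J 𝟎)) →
    let open PathSimulations 𝟎 initial in
    (A B : Obj) →
    (∀ {C : Obj} (f : C ⇒ A) (g : C ⇒ B) → IsOpen f →
    IsStrongPathSimulation R[ f , g ])
    × (Bisimilar A B →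
    Σ[ R ∈ SpanSet A B (ℓ ⊔ e) ] IsStrongPathBisimulation R)
theorem4p7 G 𝟎 initial A B =
  open⇒isStrongPathSimulation G 𝟎 initial ,
  bisimilar⇒strongPathBisimulation G 𝟎 initial
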